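{- Let $K\subsetneq 2^{[n]}$ be a proper simplicial complex such that $\mathrm{Vert}(K)=[n]$. Then $\Gamma=2^{[n]}\setminus K$ is a roughly weighted simple game with all weights strictly positive if and only if the canonical fan $Fan(\Gamma)$ of $\Gamma$ is pseudo-polytopal in the sense that it refines the normal fan of a convex polytope.
   Context: Notation: $[n]=\{1,\dots,n\}$. A simplicial complex $K\subseteq 2^{[n]}$ is a family of subsets with $\emptyset\in K$ that is closed under taking subsets; it is proper if $K\neq 2^{[n]}$. The condition $\mathrm{Vert}(K)=[n]$ means $\{i\}\in K$ for every $i\in[n]$. A simple game on $[n]$ is a family $\Gamma\subseteq 2^{[n]}$ with $[n]\in\Gamma$, $\emptyset\notin\Gamma$, that is closed under taking supersets; for proper $K$ the family $\Gamma=2^{[n]}\setminus K$ is a simple game, whose winning coalitions are the sets not in $K$. $\Gamma$ is roughly weighted (with strictly positive weights) if there exist strictly positive real numbers $w_1,\dots,w_n$ and a positive real number $q$ such that for every $X\subseteq[n]$, with $w(X)=\sum_{i\in X}w_i$: $w(X)>q$ implies $X\in\Gamma$, and $w(X)<q$ implies $X\in K$. The Alexander dual of $K$ is $K^\circ=\{A\subseteq[n] : [n]\setminus A\notin K\}$. The canonical fan $Fan(\Gamma)=Fan(K)$ lives in $H_0=\{x\in\mathbb{R}^n : x_1+\dots+x_n=0\}$. Put $\delta_i=e_i-\frac1n(e_1+\dots+e_n)$ and $\bar\delta_i=-\delta_i$ for $i\in[n]$, where $e_1,\dots,e_n$ is the standard basis of $\mathbb{R}^n$. The cones of $Fan(K)$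 are exactly the cones generated by $\{\delta_i : i\in A_1\}\cup\{\bar\delta_j : j\in A_2\}$ over all pairs $(A_1,A_2)$ with $A_1\in K$, $A_2\in K^\circ$, $A_1\cap A_2=\emptyset$. It is known that this is a complete simplicial fan in $H_0$. Normal fans are outer normal fans, with $H_0$ identified with its dual by the standard inner product. A fan $\mathcal F$ refines a fan $\mathcal N$ if every cone of $\mathcal F$ is contained in a cone of $\mathcal N$.
   Formalization: The convex polytope is required to lie in H_0 and have full dimension there; otherwise a single point, whose normal fan is {H_0}, is refined by every canonical fan and the "if" direction fails. -}

module Defs where

open import Level using (0ℓ)
open import Algebra.Bundles using (CommutativeRing)
import Algebra.Definitions.RawMonoid as RawMonoidDefs
open import Data.Bool.Base using (if_then_else_)
open import Data.Fin.Base using (Fin)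
open import Data.Fin.Properties using (_≟_)
open import Data.Fin.Subset
  using (Subset; ⊥; ⊤; ⁅_⁆; ∁; _∩_; _∈_; _⊆_; Empty)
open import Data.Fin.Subset.Properties using (⊆⊤)
open import Data.Nat.Base using (ℕ)
open import Data.Product.Base using (Σ; ∃; ∃-syntax; _×_)
open import Data.Sum.Base using (_⊎_)
open import Data.Vec.Base using (lookup)
open import Data.Vec.Functional using (Vector)
open import Relation.Binary.Core using (Rel)
open import Relation.Binary.Structures using (IsDecTotalOrder)
import Relation.Binary.Construct.NonStrictToStrict as NonStrictToStrict
open import Relation.Nullary using (¬_; does)
open import Relation.Unary using (Pred; Decidable; _≐_)
  renaming (_⊆_ to _⊆′_)

-- The classical axioms of the real numbers, which determine them up to
-- isomorphism; the reals enter every definition below as an explicit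
-- structure of this kind.
record CompleteOrderedField : Set₁ where
  field
    commutativeRing : CommutativeRing 0ℓ 0ℓ

  open CommutativeRing commutativeRing public

  infix 4 _≤_ _<_
  infix 8 _⁻¹

  field
    _≤_             : Rel Carrier 0ℓ
    isDecTotalOrder : IsDecTotalOrder _≈_ _≤_
    +-monoˡ-≤       : ∀ {x y} z → x ≤ y → x + z ≤ y + z
    *-nonneg        : ∀ {x y} → 0# ≤ x → 0# ≤ y → 0# ≤ x * y
    0≉1             : ¬ 0# ≈ 1#
    -- Total, as x ≈ 0# is decidable; nothing is assumed about 0# ⁻¹.
    _⁻¹             : Carrier → Carrier
    *-inverseʳ      : ∀ {x} → ¬ x ≈ 0# → x * x ⁻¹ ≈ 1#

  UpperBound : Pred Carrier 0ℓ → Pred Carrier 0ℓ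
  UpperBound S u = ∀ {x} → S x → x ≤ u

  field
    complete : (S : Pred Carrier 0ℓ) → ∃ S → ∃ (UpperBound S) →
               ∃[ s ] UpperBound S s × (∀ {u} → UpperBound S u → s ≤ u)

  _<_ : Rel Carrier 0ℓ
  _<_ = NonStrictToStrict._<_ _≈_ _≤_

  open RawMonoidDefs +-rawMonoid public using (sum)
  open RawMonoidDefs +-rawMonoid using () renaming (_×_ to _×ℕ_)

  fromℕ : ℕ → Carrier
  fromℕ n = n ×ℕ 1#

-- Decidability of membership makes K an ordinary (classical) family of
-- subsets of a finite set.
record SimplicialComplex (n : ℕ) : Set₁ where
  field
    Face        : Pred (Subset n) 0ℓ
    face?       : Decidable Face
    ⊥-face      : Face ⊥
    down-closed : ∀ {X Y} → X ⊆ Y → Face Y → Face X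

record SimpleGame (n : ℕ) : Set₁ where
  field
    Winning   : Pred (Subset n) 0ℓ
    ⊤-winning : Winning ⊤
    ⊥-losing  : ¬ Winning ⊥
    up-closed : ∀ {X Y} → X ⊆ Y → Winning X → Winning Y

module _ {n : ℕ} (K : SimplicialComplex n) where
  open SimplicialComplex K

  Proper : Set
  Proper = ¬ (∀ X → Face X)

  FullVertexSet : Set
  FullVertexSet = ∀ i → Face ⁅ i ⁆

  AlexanderDual : Pred (Subset n) 0ℓ
  AlexanderDual A = ¬ Face (∁ A)

  complementGame : Proper → SimpleGame n
  complementGame proper = record
    { Winning   = λ X → ¬ Face X
    ; ⊤-winning = λ ⊤∈K → proper (λ X → down-closed ⊆⊤ ⊤∈K)
    ; ⊥-losing  = λ ⊥∉K → ⊥∉K ⊥-face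
    ; up-closed = λ X⊆Y X∉K Y∈K → X∉K (down-closed X⊆Y Y∈K)
    }

module _ (ℝ : CompleteOrderedField) {n : ℕ} where
  open CompleteOrderedField ℝ

  weight : Vector Carrier n → Subset n → Carrier
  weight w X = sum (λ i → if lookup X i then w i else 0#)

  RoughlyWeighted : SimpleGame n → Set
  RoughlyWeighted Γ = ∃[ w ] ∃[ q ]
      (∀ i → 0# < w i) × 0# < q
    × (∀ X → q < weight w X → Winning X)
    × (∀ X → weight w X < q → ¬ Winning X)
    where open SimpleGame Γ

module _ (ℝ : CompleteOrderedField) (n : ℕ) where
  open CompleteOrderedField ℝ

  Point : Set
  Point = Vector Carrier n

  Region : Set₁
  Region = Pred Point 0ℓ

  -- A family of cones, given as a predicate on regions that is meant to be
  -- invariant under _≐_.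
  ConeFamily : Set₁
  ConeFamily = Pred Region 0ℓ

module _ (ℝ : CompleteOrderedField) {n : ℕ} where
  open CompleteOrderedField ℝ

  private
    V : Set
    V = Point ℝ n

  infix 4 _≋_ _Refines_
  _≋_ : Rel V 0ℓ
  x ≋ y = ∀ k → x k ≈ y k

  ⟨_,_⟩ : V → V → Carrier
  ⟨ x , y ⟩ = sum (λ k → x k * y k)

  combination : ∀ {m} → Vector Carrier m → Vector V m → V
  combination c v k = sum (λ j → c j * v j k)

  H₀ : Region ℝ n
  H₀ x = sum x ≈ 0#

  e : Fin n → V
  e i k = if does (i ≟ k) then 1# else 0#

  δ : Fin n → V
  δ i k = e i k - fromℕ n ⁻¹ * sum (λ j → e j k)

  δ̄ : Fin n → V
  δ̄ i k = - δ i k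

  ConeOf : Region ℝ n → Region ℝ n
  ConeOf G x = ∃[ m ] Σ (Vector Carrier m) λ c → Σ (Vector V m) λ g →
    (∀ j → 0# ≤ c j) × (∀ j → G (g j)) × x ≋ combination c g

  ConvexHull : ∀ {m} → Vector V m → Region ℝ n
  ConvexHull v x = ∃[ c ]
    (∀ j → 0# ≤ c j) × sum c ≈ 1# × x ≋ combination c v

  AffineHull : ∀ {m} → Vector V m → Region ℝ n
  AffineHull v x = ∃[ c ] sum c ≈ 1# × x ≋ combination c v

  CanonicalGenerators : Subset n → Subset n → Region ℝ n
  CanonicalGenerators A₁ A₂ x =
    (∃[ i ] i ∈ A₁ × x ≋ δ i) ⊎ (∃[ j ] j ∈ A₂ × x ≋ δ̄ j)

  CanonicalFan : SimplicialComplex n → ConeFamily ℝ n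
  CanonicalFan K C = Σ (Subset n) λ A₁ → Σ (Subset n) λ A₂ →
      SimplicialComplex.Face K A₁ × AlexanderDual K A₂ × Empty (A₁ ∩ A₂)
    × C ≐ ConeOf (CanonicalGenerators A₁ A₂)

  -- The face of Q on which the functional ⟨ a , _ ⟩ attains its maximum over
  -- Q.  As a ranges over H₀ these are all the nonempty faces of a polytope in
  -- H₀, with Q itself given by a = 0.
  face : Region ℝ n → V → Region ℝ n
  face Q a x = Q x × (∀ y → Q y → ⟨ a , y ⟩ ≤ ⟨ a , x ⟩)

  NormalCone : (Q F : Region ℝ n) → Region ℝ n
  NormalCone Q F a = H₀ a × F ⊆′ face Q a

  NormalFan : Region ℝ n → ConeFamily ℝ n
  NormalFan Q N = ∃[ a ] H₀ a × N ≐ NormalCone Q (face Q a)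

  _Refines_ : ConeFamily ℝ n → ConeFamily ℝ n → Set₁
  𝓕 Refines 𝓝 = ∀ C → 𝓕 C → ∃[ D ] 𝓝 D × C ⊆′ D

  -- The polytope in H₀ is required to have full dimension.  Otherwise its
  -- normal cones contain lines and do not form a fan of pointed cones; in
  -- particular every family of cones in H₀ would refine the normal fan {H₀} of
  -- a single point.
  FullDimensional : ∀ {m} → Vector V m → Set
  FullDimensional v = ∀ x → H₀ x → AffineHull v x

  PseudoPolytopal : ConeFamily ℝ n → Set₁
  PseudoPolytopal 𝓕 = ∃[ m ] Σ (Vector V m) λ v →
      (∀ j → H₀ (v j))
    × FullDimensional v
    × 𝓕 Refines NormalFan (ConvexHull v)

{-# OPTIONS --safe #-}
module Submission where

-- If Fan(K) refines the normal fan of Q, let wᵢ be the width of Q in the i-th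
-- coordinate and q minus the sum of the coordinate minima.  All functionals in
-- a cone attain their maximum over Q at a common vertex p: the cone (X, ∅)
-- forces pᵢ to be maximal on X ∈ K, the cone (∅, ∁ X) forces pᵢ to be minimal
-- off X ∉ K, and comparing with Σᵢ pᵢ = 0 gives w(X) ≤ q and w(X) ≥ q
-- respectively.
--
-- Conversely, let W be the total weight and take the section of the box
-- ∏ᵢ [- q wᵢ , (W - q) wᵢ] by H₀.  For disjoint A ∈ K and B ∈ K°, the
-- inequalities w(A) ≤ q ≤ w(∁ B) provide a point of the section with maximal
-- coordinates on A and minimal ones on B, and that point maximises every
-- functional in the cone (A, B).  The section is degenerate if q = W; this only
-- happens if K is the boundary of the simplex, where another box serves.

open import Defs
open import Data.Bool.Base using (Bool; true; false; if_then_else_)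
open import Data.Fin.Base using (Fin; zero; suc)
open import Data.Fin.Properties using (_≟_; any?)
open import Data.Fin.Subset using (Subset; ⊥; ⊤; ⁅_⁆; ∁; _∩_; _∈_; _∉_; _⊆_; Empty)
open import Data.Fin.Subset.Properties
  using (∉⊥; ∈⊤; x∈⁅x⁆; x∈⁅y⁆⇒x≡y; x∉p⇒x∈∁p; x∈p⇒x∉∁p; x∈p∩q⁻; x∈p∩q⁺; nonempty?; _∈?_)
open import Data.List.Base as List using (List; allFin; cartesianProductWith)
open import Data.List.Membership.Propositional using () renaming (_∈_ to _∈ₗ_)
open import Data.List.Membership.Propositional.Properties
  using (∈-map⁺; ∈-++⁺ˡ; ∈-++⁺ʳ; ∈-allFin; ∈-cartesianProductWith⁺)
open import Data.List.Relation.Unary.Any as Any using (here; there)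
open import Data.List.Relation.Unary.Any.Properties using (lookup-index)
open import Data.Nat.Base using (ℕ; zero; suc)
open import Data.Product.Base using (Σ; ∃-syntax; _×_; _,_; proj₁; proj₂)
open import Data.Sum.Base using (inj₁; inj₂)
open import Data.Vec.Base using (lookup; []; _∷_)
open import Data.Vec.Properties using ([]=⇒lookup; lookup⇒[]=)
open import Data.Vec.Functional using (Vector)
open import Function.Base using (_∘_; _$_)
open import Function.Bundles using (_⇔_; mk⇔)
open import Relation.Binary.Bundles using (DecTotalOrder)
open import Relation.Nullary using (¬_; ¬?; yes; no; does; contradiction)
open import Relation.Nullary.Decidable using (dec-true; dec-false; decidable-stable; _×-dec_)
open import Relation.Binary.PropositionalEquality.Core as ≡ using (_≡_; _≢_)
import Algebra.Properties.Ring as RingProperties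
import Algebra.Properties.Semiring.Sum as SemiringSum
import Algebra.Solver.Ring.NaturalCoefficients.Default as SemiringSolver
import Relation.Binary.Properties.DecTotalOrder as DecTotalOrderProperties
import Relation.Binary.Reasoning.PartialOrder as PartialOrderReasoning

-- Enumeration of the subsets of a finite set, and membership bits.

subsets : ∀ n → List (Subset n)
subsets zero    = List.[ [] ]
subsets (suc n) = cartesianProductWith _∷_ (true List.∷ false List.∷ List.[]) (subsets n)

∈-subsets : ∀ {n} (X : Subset n) → X ∈ₗ subsets n
∈-subsets []      = here ≡.refl
∈-subsets (b ∷ X) = ∈-cartesianProductWith⁺ _∷_ (∈-bools b) (∈-subsets X)
  where
  ∈-bools : ∀ b → b ∈ₗ true List.∷ false List.∷ List.[]
  ∈-bools true  = here ≡.refl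
  ∈-bools false = there (here ≡.refl)

lookup≡false⇒∉ : ∀ {n} (X : Subset n) (i : Fin n) → lookup X i ≡ false → i ∉ X
lookup≡false⇒∉ X i eq i∈X with () ← ≡.trans (≡.sym eq) ([]=⇒lookup i∈X)

∉⇒lookup≡false : ∀ {n} (X : Subset n) (i : Fin n) → i ∉ X → lookup X i ≡ false
∉⇒lookup≡false X i i∉X with lookup X i in eq
... | true  = contradiction (lookup⇒[]= i X eq) i∉X
... | false = ≡.refl

module OverReals (ℝ : CompleteOrderedField) where
  open CompleteOrderedField ℝ hiding (zero)

  decTotalOrder : DecTotalOrder _ _ _
  decTotalOrder = record { isDecTotalOrder = isDecTotalOrder }

  open DecTotalOrder decTotalOrder using (poset; antisym; total)
    renaming (refl to ≤-refl; reflexive to ≤-reflexive; trans to ≤-trans; _≟_ to _≈?_)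
  open DecTotalOrderProperties decTotalOrder using (≰⇒>; ≮⇒≥; <⇒≱; ≤∧≉⇒<)
  open RingProperties ring
    using (-‿distribˡ-*; -‿distribʳ-*; -0#≈0#; -‿involutive; -1*x≈-x; -‿injective)
  open SemiringSum semiring hiding (sum)
  open SemiringSolver commutativeSemiring using (solve; _:+_; _:*_; _:=_)
  open PartialOrderReasoning poset

  -- Ordered field arithmetic

  private variable
    x y z u v : Carrier
    n m : ℕ

  <⇒≤ : x < y → x ≤ y
  <⇒≤ = proj₁

  +-monoʳ-≤ : ∀ z → x ≤ y → z + x ≤ z + y
  +-monoʳ-≤ {x} {y} z x≤y = begin
    z + x ≈⟨ +-comm z x ⟩
    x + z ≤⟨ +-monoˡ-≤ z x≤y ⟩
    y + z ≈⟨ +-comm y z ⟩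
    z + y ∎

  +-mono-≤ : x ≤ y → u ≤ v → x + u ≤ y + v
  +-mono-≤ {x} {y} {u} {v} x≤y u≤v = ≤-trans (+-monoˡ-≤ u x≤y) (+-monoʳ-≤ y u≤v)

  -z+[z+x]≈x : ∀ z x → - z + (z + x) ≈ x
  -z+[z+x]≈x z x = begin-equality
    - z + (z + x) ≈⟨ +-assoc _ _ _ ⟨
    - z + z + x   ≈⟨ +-congʳ (-‿inverseˡ z) ⟩
    0# + x        ≈⟨ +-identityˡ x ⟩
    x             ∎

  +-cancelˡ-≤ : ∀ z → z + x ≤ z + y → x ≤ y
  +-cancelˡ-≤ {x} {y} z z+x≤z+y = begin
    x             ≈⟨ -z+[z+x]≈x z x ⟨
    - z + (z + x) ≤⟨ +-monoʳ-≤ (- z) z+x≤z+y ⟩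
    - z + (z + y) ≈⟨ -z+[z+x]≈x z y ⟩
    y             ∎

  +-mono-≤-< : x ≤ y → u < v → x + u < y + v
  +-mono-≤-< {x} {y} {u} {v} x≤y u<v = ≰⇒> λ y+v≤x+u →
    <⇒≱ u<v (+-cancelˡ-≤ x (≤-trans (+-monoˡ-≤ v x≤y) y+v≤x+u))

  +-mono-<-≤ : x < y → u ≤ v → x + u < y + v
  +-mono-<-≤ {x} {y} {u} {v} x<y u≤v = begin-strict
    x + u ≈⟨ +-comm x u ⟩
    u + x <⟨ +-mono-≤-< u≤v x<y ⟩
    v + y ≈⟨ +-comm v y ⟩
    y + v ∎

  x-x≈0 : x - x ≈ 0#
  x-x≈0 {x} = -‿inverseʳ x

  x≤y⇒0≤y-x : x ≤ y → 0# ≤ y - x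
  x≤y⇒0≤y-x {x} {y} x≤y = begin
    0#    ≈⟨ x-x≈0 ⟨
    x - x ≤⟨ +-monoˡ-≤ (- x) x≤y ⟩
    y - x ∎

  x<y⇒0<y-x : x < y → 0# < y - x
  x<y⇒0<y-x {x} {y} x<y = begin-strict
    0#    ≈⟨ x-x≈0 ⟨
    x - x <⟨ +-mono-<-≤ x<y ≤-refl ⟩
    y - x ∎

  [y-x]+x≈y : ∀ x y → (y - x) + x ≈ y
  [y-x]+x≈y x y = begin-equality
    (y - x) + x   ≈⟨ +-assoc _ _ _ ⟩
    y + (- x + x) ≈⟨ +-congˡ (-‿inverseˡ x) ⟩
    y + 0#        ≈⟨ +-identityʳ y ⟩
    y             ∎

  0≤y-x⇒x≤y : 0# ≤ y - x → x ≤ y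
  0≤y-x⇒x≤y {y} {x} 0≤y-x = begin
    x           ≈⟨ +-identityˡ x ⟨
    0# + x      ≤⟨ +-monoˡ-≤ x 0≤y-x ⟩
    (y - x) + x ≈⟨ [y-x]+x≈y x y ⟩
    y           ∎

  neg-antimono-≤ : x ≤ y → - y ≤ - x
  neg-antimono-≤ {x} {y} x≤y = 0≤y-x⇒x≤y (begin
    0#        ≤⟨ x≤y⇒0≤y-x x≤y ⟩
    y - x     ≈⟨ +-comm _ _ ⟩
    - x + y   ≈⟨ +-congˡ (-‿involutive y) ⟨
    - x - - y ∎)

  0≤-x : x ≤ 0# → 0# ≤ - x
  0≤-x x≤0 = ≤-trans (≤-reflexive (sym -0#≈0#)) (neg-antimono-≤ x≤0)

  -x≤0 : 0# ≤ x → - x ≤ 0#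
  -x≤0 0≤x = ≤-trans (neg-antimono-≤ 0≤x) (≤-reflexive -0#≈0#)

  0<-x : x < 0# → 0# < - x
  0<-x {x} x<0 = ≰⇒> λ -x≤0 → <⇒≱ x<0 (≤-trans (0≤-x -x≤0) (≤-reflexive (-‿involutive x)))

  -x<0 : 0# < x → - x < 0#
  -x<0 {x} 0<x = ≰⇒> λ 0≤-x → <⇒≱ 0<x (≤-trans (≤-reflexive (sym (-‿involutive x))) (-x≤0 0≤-x))

  *-monoˡ-≤-nonneg : 0# ≤ z → x ≤ y → z * x ≤ z * y
  *-monoˡ-≤-nonneg {z} {x} {y} 0≤z x≤y = 0≤y-x⇒x≤y (begin
    0#                ≤⟨ *-nonneg 0≤z (x≤y⇒0≤y-x x≤y) ⟩
    z * (y - x)       ≈⟨ distribˡ z y (- x) ⟩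
    z * y + z * - x   ≈⟨ +-congˡ (-‿distribʳ-* z x) ⟨
    z * y - z * x     ∎)

  -- If 1 ≤ 0, then -1 is nonnegative and so is its square 1, which forces 0 = 1.
  0<1 : 0# < 1#
  0<1 = ≰⇒> λ 1≤0 → 0≉1 $ antisym
    (begin
      0#            ≤⟨ *-nonneg (0≤-x 1≤0) (0≤-x 1≤0) ⟩
      - 1# * - 1#   ≈⟨ -1*x≈-x (- 1#) ⟩
      - - 1#        ≈⟨ -‿involutive 1# ⟩
      1#            ∎)
    1≤0

  *-inverseˡ : ¬ x ≈ 0# → x ⁻¹ * x ≈ 1#
  *-inverseˡ x≉0 = trans (*-comm _ _) (*-inverseʳ x≉0)

  0<⇒≉0 : 0# < x → ¬ x ≈ 0#
  0<⇒≉0 0<x x≈0 = proj₂ 0<x (sym x≈0)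

  *-pos : 0# < x → 0# < y → 0# < x * y
  *-pos {x} {y} 0<x 0<y = ≤∧≉⇒< (*-nonneg (<⇒≤ 0<x) (<⇒≤ 0<y)) λ 0≈xy → 0<⇒≉0 0<y (begin-equality
    y              ≈⟨ *-identityˡ y ⟨
    1# * y         ≈⟨ *-congʳ (*-inverseˡ (0<⇒≉0 0<x)) ⟨
    x ⁻¹ * x * y   ≈⟨ *-assoc _ _ _ ⟩
    x ⁻¹ * (x * y) ≈⟨ *-congˡ 0≈xy ⟨
    x ⁻¹ * 0#      ≈⟨ zeroʳ _ ⟩
    0#             ∎)

  ⁻¹-nonneg : 0# < x → 0# ≤ x ⁻¹
  ⁻¹-nonneg {x} 0<x = ≮⇒≥ λ x⁻¹<0 → <⇒≱ 0<1 (begin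
    1#              ≈⟨ *-inverseʳ (0<⇒≉0 0<x) ⟨
    x * x ⁻¹        ≤⟨ *-monoˡ-≤-nonneg (<⇒≤ 0<x) (<⇒≤ x⁻¹<0) ⟩
    x * 0#          ≈⟨ zeroʳ x ⟩
    0#              ∎)

  fromℕ-nonneg : ∀ n → 0# ≤ fromℕ n
  fromℕ-nonneg zero    = ≤-refl
  fromℕ-nonneg (suc n) = ≤-trans (≤-reflexive (sym (+-identityˡ 0#))) (+-mono-≤ (<⇒≤ 0<1) (fromℕ-nonneg n))

  0<fromℕ[1+n] : ∀ n → 0# < fromℕ (suc n)
  0<fromℕ[1+n] n = begin-strict
    0#           ≈⟨ +-identityˡ 0# ⟨
    0# + 0#      <⟨ +-mono-<-≤ 0<1 (fromℕ-nonneg n) ⟩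
    1# + fromℕ n ∎

  -x≤y⇒0≤x+y : - x ≤ y → 0# ≤ x + y
  -x≤y⇒0≤x+y {x} {y} -x≤y = begin
    0#    ≈⟨ x-x≈0 ⟨
    x - x ≤⟨ +-monoʳ-≤ x -x≤y ⟩
    x + y ∎

  y≤-x⇒x+y≤0 : y ≤ - x → x + y ≤ 0#
  y≤-x⇒x+y≤0 {y} {x} y≤-x = begin
    x + y ≤⟨ +-monoʳ-≤ x y≤-x ⟩
    x - x ≈⟨ x-x≈0 ⟩
    0#    ∎

  common-lower-bound : 0# < x → 0# < y → ∃[ ε ] 0# < ε × ε ≤ x × ε ≤ y
  common-lower-bound {x} {y} 0<x 0<y with total x y
  ... | inj₁ x≤y = x , 0<x , ≤-refl , x≤y
  ... | inj₂ y≤x = y , 0<y , y≤x , ≤-refl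

  positive-lower-bound : (f : Vector Carrier n) → (∀ i → 0# < f i) → ∃[ ε ] 0# < ε × (∀ i → ε ≤ f i)
  -- With no entries to bound, any positive value serves.
  positive-lower-bound {zero}  f 0<f = 1# , 0<1 , λ ()
  positive-lower-bound {suc n} f 0<f
    with positive-lower-bound (f ∘ suc) (0<f ∘ suc)
  ... | ε , 0<ε , ε≤f with common-lower-bound (0<f zero) 0<ε
  ... | η , 0<η , η≤f₀ , η≤ε = η , 0<η , λ where
    zero    → η≤f₀
    (suc i) → ≤-trans η≤ε (ε≤f i)

  -- The weights are y/(y-x) and -x/(y-x). If x ≈ y, both numbers vanish and the quotients are
  -- replaced by 1 and 0. With coordinate sums as x and y, this locates the point where a segment
  -- meets `H₀`.
  convex-zero : x ≤ 0# → 0# ≤ y →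
                ∃[ s ] ∃[ t ] 0# ≤ s × 0# ≤ t × s + t ≈ 1# × s * x + t * y ≈ 0#
  convex-zero {x} {y} x≤0 0≤y with x ≈? y
  ... | yes x≈y = 1# , 0# , <⇒≤ 0<1 , ≤-refl , +-identityʳ 1# , (begin-equality
    1# * x + 0# * y ≈⟨ +-cong (*-identityˡ x) (zeroˡ y) ⟩
    x + 0#          ≈⟨ +-identityʳ x ⟩
    x               ≈⟨ antisym x≤0 (≤-trans 0≤y (≤-reflexive (sym x≈y))) ⟩
    0#              ∎)
  ... | no  x≉y = y * d , - x * d , *-nonneg 0≤y 0≤d , *-nonneg (0≤-x x≤0) 0≤d ,
    trans (sym (distribʳ d y (- x))) (*-inverseʳ (0<⇒≉0 0<y-x)) ,
    (begin-equality
      y * d * x + - x * d * y ≈⟨ solve 4 (λ x y z d → y :* d :* x :+ z :* d :* y := (x :+ z) :* (d :* y)) refl x y (- x) d ⟩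
      (x - x) * (d * y)       ≈⟨ *-congʳ x-x≈0 ⟩
      0# * (d * y)            ≈⟨ zeroˡ _ ⟩
      0#                      ∎)
    where
    d = (y - x) ⁻¹
    0<y-x = x<y⇒0<y-x (≤∧≉⇒< (≤-trans x≤0 0≤y) x≉y)
    0≤d = ⁻¹-nonneg 0<y-x

  convex-const : ∀ {s t} → s + t ≈ 1# → ∀ x → s * x + t * x ≈ x
  convex-const {s} {t} s+t≈1 x = trans (sym (distribʳ x s t)) (trans (*-congʳ s+t≈1) (*-identityˡ x))

  convex-interval : ∀ {s t} → 0# ≤ s → 0# ≤ t → s + t ≈ 1# →
                    x ≤ u × u ≤ y → x ≤ v × v ≤ y → x ≤ s * u + t * v × s * u + t * v ≤ y
  convex-interval {x} {u} {y} {v} {s} {t} 0≤s 0≤t s+t≈1 (x≤u , u≤y) (x≤v , v≤y) =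
    (begin
      x             ≈⟨ convex-const s+t≈1 x ⟨
      s * x + t * x ≤⟨ +-mono-≤ (*-monoˡ-≤-nonneg 0≤s x≤u) (*-monoˡ-≤-nonneg 0≤t x≤v) ⟩
      s * u + t * v ∎) ,
    (begin
      s * u + t * v ≤⟨ +-mono-≤ (*-monoˡ-≤-nonneg 0≤s u≤y) (*-monoˡ-≤-nonneg 0≤t v≤y) ⟩
      s * y + t * y ≈⟨ convex-const s+t≈1 y ⟩
      y             ∎)

  -- Sums

  sum-mono-≤ : {f g : Vector Carrier n} → (∀ i → f i ≤ g i) → sum f ≤ sum g
  sum-mono-≤ {zero}  f≤g = ≤-refl
  sum-mono-≤ {suc n} f≤g = +-mono-≤ (f≤g zero) (sum-mono-≤ (f≤g ∘ suc))

  sum-mono-< : {f g : Vector Carrier n} → (∀ i → f i ≤ g i) → ∀ i → f i < g i → sum f < sum g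
  sum-mono-< f≤g zero    f₀<g₀ = +-mono-<-≤ f₀<g₀ (sum-mono-≤ (f≤g ∘ suc))
  sum-mono-< f≤g (suc i) fᵢ<gᵢ = +-mono-≤-< (f≤g zero) (sum-mono-< (f≤g ∘ suc) i fᵢ<gᵢ)

  -- One strict coordinate would already make the sums strict. This turns optimality of a total into
  -- equality in every coordinate.
  sum-tight : {f g : Vector Carrier n} → (∀ i → f i ≤ g i) → sum g ≤ sum f → ∀ i → f i ≈ g i
  sum-tight {f = f} {g} f≤g Σg≤Σf i with f i ≈? g i
  ... | yes fᵢ≈gᵢ = fᵢ≈gᵢ
  ... | no  fᵢ≉gᵢ = contradiction Σg≤Σf (<⇒≱ (sum-mono-< f≤g i (≤∧≉⇒< (f≤g i) fᵢ≉gᵢ)))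

  sum-zero : {f : Vector Carrier n} → (∀ i → f i ≈ 0#) → sum f ≈ 0#
  sum-zero {n} f≈0 = trans (sum-cong-≋ f≈0) (sum-replicate-zero n)

  sum-nonneg : {f : Vector Carrier n} → (∀ i → 0# ≤ f i) → 0# ≤ sum f
  sum-nonneg {n} 0≤f = ≤-trans (≤-reflexive (sym (sum-replicate-zero n))) (sum-mono-≤ 0≤f)

  sum-pos : {f : Vector Carrier n} → (∀ i → 0# ≤ f i) → ∀ i → 0# < f i → 0# < sum f
  sum-pos {n} {f} 0≤f i 0<fᵢ = begin-strict
    0#                   ≈⟨ sum-replicate-zero n ⟨
    sum {n} (λ _ → 0#)   <⟨ sum-mono-< 0≤f i 0<fᵢ ⟩
    sum f                ∎

  sum-affine : ∀ x y (f g : Vector Carrier n) → sum (λ i → x * f i + y * g i) ≈ x * sum f + y * sum g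
  sum-affine x y f g = trans (∑-distrib-+ (λ i → x * f i) (λ i → y * g i)) (+-cong (sym (*-distribˡ-sum x f)) (sym (*-distribˡ-sum y g)))

  sum-neg : (f : Vector Carrier n) → sum (λ i → - f i) ≈ - sum f
  sum-neg f = begin-equality
    sum (λ i → - f i)       ≈⟨ sum-cong-≋ (λ i → -1*x≈-x (f i)) ⟨
    sum (λ i → - 1# * f i)  ≈⟨ *-distribˡ-sum (- 1#) f ⟨
    - 1# * sum f            ≈⟨ -1*x≈-x (sum f) ⟩
    - sum f                 ∎

  sum-ones : ∀ n → sum {n} (λ _ → 1#) ≈ fromℕ n
  sum-ones n = sum-replicate n

  weighted-mono : {c f g : Vector Carrier n} → (∀ j → 0# ≤ c j) → (∀ j → f j ≤ g j) →
                  sum (λ j → c j * f j) ≤ sum (λ j → c j * g j)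
  weighted-mono 0≤c f≤g = sum-mono-≤ (λ j → *-monoˡ-≤-nonneg (0≤c j) (f≤g j))

  weighted-const : (c : Vector Carrier n) → sum c ≈ 1# → ∀ s → sum (λ j → c j * s) ≈ s
  weighted-const c Σc≈1 s = begin-equality
    sum (λ j → c j * s) ≈⟨ *-distribʳ-sum s c ⟨
    sum c * s           ≈⟨ *-congʳ Σc≈1 ⟩
    1# * s              ≈⟨ *-identityˡ s ⟩
    s                   ∎

  argmax : (f : Vector Carrier (suc n)) → ∃[ i ] (∀ j → f j ≤ f i)
  argmax {zero}  f = zero , λ { zero → ≤-refl }
  argmax {suc n} f with argmax (f ∘ suc)
  ... | i , f≤fᵢ with total (f zero) (f (suc i))
  ...   | inj₁ f₀≤fᵢ = suc i , λ { zero → f₀≤fᵢ ; (suc j) → f≤fᵢ j }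
  ...   | inj₂ fᵢ≤f₀ = zero  , λ { zero → ≤-refl ; (suc j) → ≤-trans (f≤fᵢ j) fᵢ≤f₀ }

  -- Points and polytopes

  V : ℕ → Set
  V = Point ℝ

  infix 7 _·_
  _·_ : V n → V n → Carrier
  a · b = ⟨_,_⟩ ℝ a b

  e-bounds : (i k : Fin n) → 0# ≤ e ℝ i k × e ℝ i k ≤ 1#
  e-bounds i k with does (i ≟ k)
  ... | true  = <⇒≤ 0<1 , ≤-refl
  ... | false = ≤-refl , <⇒≤ 0<1

  e-sym : (i k : Fin n) → e ℝ i k ≡ e ℝ k i
  e-sym zero    zero    = ≡.refl
  e-sym zero    (suc k) = ≡.refl
  e-sym (suc i) zero    = ≡.refl
  e-sym (suc i) (suc k) = e-sym i k

  e-diagonal : (i : Fin n) → e ℝ i i ≡ 1#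
  e-diagonal i rewrite dec-true (i ≟ i) ≡.refl = ≡.refl

  e-off-diagonal : {i k : Fin n} → i ≢ k → e ℝ i k ≡ 0#
  e-off-diagonal {i = i} {k} i≢k rewrite dec-false (i ≟ k) i≢k = ≡.refl

  sum-e* : (i : Fin n) (f : Vector Carrier n) → sum (λ j → e ℝ i j * f j) ≈ f i
  sum-e* zero f = begin-equality
    1# * f zero + sum (λ j → 0# * f (suc j)) ≈⟨ +-cong (*-identityˡ _) (sum-zero (λ j → zeroˡ (f (suc j)))) ⟩
    f zero + 0#                              ≈⟨ +-identityʳ _ ⟩
    f zero                                   ∎
  sum-e* (suc i) f = begin-equality
    0# * f zero + sum (λ j → e ℝ i j * f (suc j)) ≈⟨ +-cong (zeroˡ _) (sum-e* i (f ∘ suc)) ⟩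
    0# + f (suc i)                                ≈⟨ +-identityˡ _ ⟩
    f (suc i)                                     ∎

  sum-e : (i : Fin n) → sum (e ℝ i) ≈ 1#
  sum-e i = trans (sum-cong-≋ (λ j → sym (*-identityʳ (e ℝ i j)))) (sum-e* i (λ _ → 1#))

  sum-e-column : (k : Fin n) → sum (λ j → e ℝ j k) ≈ 1#
  sum-e-column k = trans (sum-cong-≋ (λ j → reflexive (e-sym j k))) (sum-e k)

  ·-comm : (a b : V n) → a · b ≈ b · a
  ·-comm a b = sum-cong-≋ (λ k → *-comm (a k) (b k))

  ·-congˡ : {a b b′ : V n} → _≋_ ℝ b b′ → a · b ≈ a · b′
  ·-congˡ b≋b′ = sum-cong-≋ (λ k → *-congˡ (b≋b′ k))

  ·-congʳ : {a a′ b : V n} → _≋_ ℝ a a′ → a · b ≈ a′ · b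
  ·-congʳ a≋a′ = sum-cong-≋ (λ k → *-congʳ (a≋a′ k))

  combination-· : (c : Vector Carrier m) (g : Vector (V n) m) (b : V n) →
                  combination ℝ c g · b ≈ sum (λ j → c j * (g j · b))
  combination-· c g b = begin-equality
    sum (λ k → sum (λ j → c j * g j k) * b k)   ≈⟨ sum-cong-≋ (λ k → *-distribʳ-sum (b k) (λ j → c j * g j k)) ⟩
    sum (λ k → sum (λ j → c j * g j k * b k))   ≈⟨ ∑-comm (λ k j → c j * g j k * b k) ⟩
    sum (λ j → sum (λ k → c j * g j k * b k))   ≈⟨ sum-cong-≋ (λ j → sum-cong-≋ (λ k → *-assoc (c j) (g j k) (b k))) ⟩
    sum (λ j → sum (λ k → c j * (g j k * b k))) ≈⟨ sum-cong-≋ (λ j → *-distribˡ-sum (c j) (λ k → g j k * b k)) ⟨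
    sum (λ j → c j * (g j · b))                 ∎

  ·-combination : (a : V n) (c : Vector Carrier m) (g : Vector (V n) m) →
                  a · combination ℝ c g ≈ sum (λ j → c j * (a · g j))
  ·-combination a c g = begin-equality
    a · combination ℝ c g       ≈⟨ ·-comm a (combination ℝ c g) ⟩
    combination ℝ c g · a       ≈⟨ combination-· c g a ⟩
    sum (λ j → c j * (g j · a)) ≈⟨ sum-cong-≋ (λ j → *-congˡ (·-comm (g j) a)) ⟩
    sum (λ j → c j * (a · g j)) ∎

  H₀-resp-≋ : {a b : V n} → _≋_ ℝ a b → H₀ ℝ b → H₀ ℝ a
  H₀-resp-≋ a≋b Σb≈0 = trans (sum-cong-≋ a≋b) Σb≈0

  H₀-combination : (c : Vector Carrier m) (g : Vector (V n) m) →
                   (∀ j → H₀ ℝ (g j)) → H₀ ℝ (combination ℝ c g)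
  H₀-combination c g g∈H₀ = begin-equality
    sum (λ k → sum (λ j → c j * g j k)) ≈⟨ ∑-comm (λ k j → c j * g j k) ⟩
    sum (λ j → sum (λ k → c j * g j k)) ≈⟨ sum-cong-≋ (λ j → *-distribˡ-sum (c j) (g j)) ⟨
    sum (λ j → c j * sum (g j))         ≈⟨ sum-zero (λ j → trans (*-congˡ (g∈H₀ j)) (zeroʳ (c j))) ⟩
    0#                                  ∎

  e-e∈H₀ : (i k : Fin n) → H₀ ℝ (λ j → e ℝ i j - e ℝ k j)
  e-e∈H₀ i k = begin-equality
    sum (λ j → e ℝ i j - e ℝ k j)          ≈⟨ ∑-distrib-+ (e ℝ i) (λ j → - e ℝ k j) ⟩
    sum (e ℝ i) + sum (λ j → - e ℝ k j)    ≈⟨ +-cong (sum-e i) (trans (sum-neg (e ℝ k)) (-‿cong (sum-e k))) ⟩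
    1# - 1#                                ≈⟨ x-x≈0 ⟩
    0#                                     ∎

  vertex∈hull : (v : Vector (V n) m) (j : Fin m) → ConvexHull ℝ v (v j)
  vertex∈hull v j = e ℝ j , proj₁ ∘ e-bounds j , sum-e j , λ k → sym (sum-e* j (λ i → v i k))

  H₀-hull : (v : Vector (V n) m) → (∀ j → H₀ ℝ (v j)) → ∀ {b} → ConvexHull ℝ v b → H₀ ℝ b
  H₀-hull v v∈H₀ (c , _ , _ , b≋cv) = H₀-resp-≋ b≋cv (H₀-combination c v v∈H₀)

  hull-upper : (a : V n) (v : Vector (V n) m) → (∀ j → a · v j ≤ x) → ∀ {b} → ConvexHull ℝ v b → a · b ≤ x
  hull-upper {x = x} a v av≤x {b} (c , 0≤c , Σc≈1 , b≋cv) = begin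
    a · b                       ≈⟨ ·-congˡ {a = a} b≋cv ⟩
    a · combination ℝ c v       ≈⟨ ·-combination a c v ⟩
    sum (λ j → c j * (a · v j)) ≤⟨ weighted-mono 0≤c av≤x ⟩
    sum (λ j → c j * x)         ≈⟨ weighted-const c Σc≈1 x ⟩
    x                           ∎

  hull-interval : (v : Vector (V n) m) (k : Fin n) → (∀ j → x ≤ v j k × v j k ≤ y) →
                  ∀ {b} → ConvexHull ℝ v b → x ≤ b k × b k ≤ y
  hull-interval {x = x} {y} v k bounds {b} (c , 0≤c , Σc≈1 , b≋cv) =
    (begin
      x                       ≈⟨ weighted-const c Σc≈1 x ⟨
      sum (λ j → c j * x)     ≤⟨ weighted-mono 0≤c (proj₁ ∘ bounds) ⟩
      sum (λ j → c j * v j k) ≈⟨ b≋cv k ⟨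
      b k                     ∎) ,
    (begin
      b k                     ≈⟨ b≋cv k ⟩
      sum (λ j → c j * v j k) ≤⟨ weighted-mono 0≤c (proj₂ ∘ bounds) ⟩
      sum (λ j → c j * y)     ≈⟨ weighted-const c Σc≈1 y ⟩
      y                       ∎)

  -- Coefficients of sum 1 reproduce a constant. Together with full dimension, this makes a
  -- coordinate of width zero constant on all of `H₀`.
  affineHull-const : (v : Vector (V n) m) (k : Fin n) → (∀ j → v j k ≈ x) →
                     ∀ {b} → AffineHull ℝ v b → b k ≈ x
  affineHull-const {x = x} v k v≈x {b} (c , Σc≈1 , b≋cv) = begin-equality
    b k                     ≈⟨ b≋cv k ⟩
    sum (λ j → c j * v j k) ≈⟨ sum-cong-≋ (λ j → *-congˡ (v≈x j)) ⟩
    sum (λ j → c j * x)     ≈⟨ weighted-const c Σc≈1 x ⟩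
    x                       ∎

  -- The new coefficient of point j collects every `c i` with `ι i` equal to j. Full dimension thus
  -- passes from a subfamily of points to the whole family.
  affineHull-reindex : ∀ {p} (v : Vector (V n) m) (ι : Fin p → Fin m) →
                       ∀ {b} → AffineHull ℝ (v ∘ ι) b → AffineHull ℝ v b
  affineHull-reindex {m = m} {p = p} v ι {b} (c , Σc≈1 , b≋cvι) = c′ , Σc′≈1 , b≋c′v
    where
    c′ : Vector Carrier m
    c′ j = sum (λ i → c i * e ℝ (ι i) j)

    Σc′≈1 : sum c′ ≈ 1#
    Σc′≈1 = begin-equality
      sum (λ j → sum (λ i → c i * e ℝ (ι i) j)) ≈⟨ ∑-comm (λ j i → c i * e ℝ (ι i) j) ⟩
      sum (λ i → sum (λ j → c i * e ℝ (ι i) j)) ≈⟨ sum-cong-≋ (λ i → *-distribˡ-sum (c i) (e ℝ (ι i))) ⟨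
      sum (λ i → c i * sum (e ℝ (ι i)))         ≈⟨ sum-cong-≋ (λ i → trans (*-congˡ (sum-e (ι i))) (*-identityʳ (c i))) ⟩
      sum c                                     ≈⟨ Σc≈1 ⟩
      1#                                        ∎

    b≋c′v : _≋_ ℝ b (combination ℝ c′ v)
    b≋c′v k = begin-equality
      b k                                                 ≈⟨ b≋cvι k ⟩
      sum (λ i → c i * v (ι i) k)                         ≈⟨ sum-cong-≋ (λ i → *-congˡ (e-·-column i)) ⟨
      sum (λ i → c i * (e ℝ (ι i) · column))              ≈⟨ combination-· c (λ i → e ℝ (ι i)) column ⟨
      sum (λ j → c′ j * v j k)                            ∎
      where
      column : V m
      column j = v j k

      e-·-column : ∀ i → e ℝ (ι i) · column ≈ v (ι i) k
      e-·-column i = sum-e* (ι i) column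

  -- The argument in `Fin n` certifies that n is positive.
  fromℕ≉0 : Fin n → ¬ fromℕ n ≈ 0#
  fromℕ≉0 {suc n} _ = 0<⇒≉0 (0<fromℕ[1+n] n)

  δ≈ : (i k : Fin n) → δ ℝ i k ≈ e ℝ i k - fromℕ n ⁻¹
  δ≈ i k = +-congˡ (-‿cong (trans (*-congˡ (sum-e-column k)) (*-identityʳ _)))

  δ∈H₀ : (i : Fin n) → H₀ ℝ (δ ℝ i)
  δ∈H₀ {n} i = begin-equality
    sum (δ ℝ i)                              ≈⟨ sum-cong-≋ (δ≈ i) ⟩
    sum (λ k → e ℝ i k - r)                  ≈⟨ ∑-distrib-+ (e ℝ i) (λ _ → - r) ⟩
    sum (e ℝ i) + sum {n} (λ _ → - r)        ≈⟨ +-cong (sum-e i) (sum-neg {n} (λ _ → r)) ⟩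
    1# - sum {n} (λ _ → r)                   ≈⟨ +-congˡ (-‿cong (sum-cong-≋ {n} (λ _ → *-identityʳ r))) ⟨
    1# - sum {n} (λ _ → r * 1#)              ≈⟨ +-congˡ (-‿cong (*-distribˡ-sum {n} r (λ _ → 1#))) ⟨
    1# - r * sum {n} (λ _ → 1#)              ≈⟨ +-congˡ (-‿cong (*-congˡ (sum-ones n))) ⟩
    1# - r * fromℕ n                         ≈⟨ +-congˡ (-‿cong (*-inverseˡ (fromℕ≉0 i))) ⟩
    1# - 1#                                  ≈⟨ x-x≈0 ⟩
    0#                                       ∎
    where r = fromℕ n ⁻¹

  δ̄∈H₀ : (i : Fin n) → H₀ ℝ (δ̄ ℝ i)
  δ̄∈H₀ i = trans (sum-neg (δ ℝ i)) (trans (-‿cong (δ∈H₀ i)) -0#≈0#)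

  -- `δ i` differs from `e i` by a multiple of the all-ones vector, which is orthogonal to `H₀`.
  -- Generators of the fan therefore read off coordinates up to sign.
  δ-· : (i : Fin n) {b : V n} → H₀ ℝ b → δ ℝ i · b ≈ b i
  δ-· {n} i {b} Σb≈0 = begin-equality
    δ ℝ i · b                                    ≈⟨ ·-congʳ {b = b} (δ≈ i) ⟩
    sum (λ k → (e ℝ i k - r) * b k)              ≈⟨ sum-cong-≋ (λ k → distribʳ (b k) (e ℝ i k) (- r)) ⟩
    sum (λ k → e ℝ i k * b k + - r * b k)        ≈⟨ ∑-distrib-+ (λ k → e ℝ i k * b k) (λ k → - r * b k) ⟩
    e ℝ i · b + sum (λ k → - r * b k)            ≈⟨ +-cong (sum-e* i b) (sym (*-distribˡ-sum (- r) b)) ⟩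
    b i + - r * sum b                            ≈⟨ +-congˡ (trans (*-congˡ Σb≈0) (zeroʳ (- r))) ⟩
    b i + 0#                                     ≈⟨ +-identityʳ (b i) ⟩
    b i                                          ∎
    where r = fromℕ n ⁻¹

  δ̄-· : (i : Fin n) {b : V n} → H₀ ℝ b → δ̄ ℝ i · b ≈ - b i
  δ̄-· i {b} Σb≈0 = begin-equality
    sum (λ k → - δ ℝ i k * b k)   ≈⟨ sum-cong-≋ (λ k → -‿distribˡ-* (δ ℝ i k) (b k)) ⟨
    sum (λ k → - (δ ℝ i k * b k)) ≈⟨ sum-neg (λ k → δ ℝ i k * b k) ⟩
    - (δ ℝ i · b)                 ≈⟨ -‿cong (δ-· i Σb≈0) ⟩
    - b i                         ∎

  -- Weights and corners of boxes.

  weight-pos : {w : V n} → (∀ i → 0# < w i) → ∀ {X i} → i ∈ X → 0# < weight ℝ w X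
  weight-pos {w = w} 0<w {X} {i} i∈X = sum-pos nonneg i pos
    where
    nonneg : ∀ k → 0# ≤ (if lookup X k then w k else 0#)
    nonneg k with lookup X k
    ... | true  = <⇒≤ (0<w k)
    ... | false = ≤-refl

    pos : 0# < (if lookup X i then w i else 0#)
    pos rewrite []=⇒lookup i∈X = 0<w i

  -- The corners of the box with sides [l i , r i], indexed by the set of coordinates at their upper
  -- ends.
  mix : (l r : V n) → Subset n → V n
  mix l r X i = if lookup X i then r i else l i

  module _ {l r : V n} {X : Subset n} {i : Fin n} where

    mix-∈ : i ∈ X → mix l r X i ≡ r i
    mix-∈ i∈X rewrite []=⇒lookup i∈X = ≡.refl

    mix-∉ : i ∉ X → mix l r X i ≡ l i
    mix-∉ i∉X rewrite ∉⇒lookup≡false X i i∉X = ≡.refl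

  -- The coefficient of δᵢ in the sum of the generators of the cone (A, B), from the membership bits
  -- of i in A and in B.
  sign : Bool → Bool → Carrier
  sign true  _     = 1#
  sign false true  = - 1#
  sign false false = 0#

  -- Canonical cones

  generator∈H₀ : (A B : Subset n) → ∀ {g} → CanonicalGenerators ℝ A B g → H₀ ℝ g
  generator∈H₀ A B (inj₁ (i , _ , g≋δ)) = H₀-resp-≋ g≋δ (δ∈H₀ i)
  generator∈H₀ A B (inj₂ (i , _ , g≋δ̄)) = H₀-resp-≋ g≋δ̄ (δ̄∈H₀ i)

  cone⊆H₀ : (A B : Subset n) → ∀ {a} → ConeOf ℝ (CanonicalGenerators ℝ A B) a → H₀ ℝ a
  cone⊆H₀ A B (_ , c , g , _ , g∈G , a≋cg) =
    H₀-resp-≋ a≋cg (H₀-combination c g (generator∈H₀ A B ∘ g∈G))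

  generator∈cone : {G : Region ℝ n} → ∀ {g} → G g → ConeOf ℝ G g
  generator∈cone {g = g} g∈G = 1 , (λ _ → 1#) , (λ _ → g) , (λ _ → <⇒≤ 0<1) , (λ _ → g∈G) ,
    λ k → sym (trans (+-identityʳ _) (*-identityˡ (g k)))

  δ∈cone : {A B : Subset n} → ∀ {i} → i ∈ A → ConeOf ℝ (CanonicalGenerators ℝ A B) (δ ℝ i)
  δ∈cone {A = A} {B} {i} i∈A = generator∈cone {G = CanonicalGenerators ℝ A B} (inj₁ (i , i∈A , λ _ → refl))

  δ̄∈cone : {A B : Subset n} → ∀ {i} → i ∈ B → ConeOf ℝ (CanonicalGenerators ℝ A B) (δ̄ ℝ i)
  δ̄∈cone {A = A} {B} {i} i∈B = generator∈cone {G = CanonicalGenerators ℝ A B} (inj₂ (i , i∈B , λ _ → refl))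

  -- Complexes that contain all vertices but not the whole set.

  module _ (K : SimplicialComplex n) (proper : Proper K) (vertices : FullVertexSet K) where
    open SimplicialComplex K

    ⊤∉K : ¬ Face ⊤
    ⊤∉K ⊤∈K = proper (λ X → down-closed (λ _ → ∈⊤) ⊤∈K)

    ⊥∈K° : AlexanderDual K ⊥
    ⊥∈K° ∁⊥∈K = ⊤∉K (down-closed (λ _ → x∉p⇒x∈∁p ∉⊥) ∁⊥∈K)

    ∁-nonface : ∀ {X} → ¬ Face X → AlexanderDual K (∁ X)
    ∁-nonface X∉K ∁∁X∈K = X∉K (down-closed (λ i∈X → x∉p⇒x∈∁p (x∈p⇒x∉∁p i∈X)) ∁∁X∈K)

    ∃-outside-face : ∀ {X} → Face X → ∃[ i ] i ∉ X
    ∃-outside-face {X} X∈K with any? (λ i → ¬? (i ∈? X))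
    ... | yes i∉X = i∉X
    ... | no  ∄i∉X = contradiction (down-closed (λ {i} _ → decidable-stable (i ∈? X) (λ i∉X → ∄i∉X (i , i∉X))) X∈K) ⊤∉K

    -- A singleton is a face and `⊤` is not, so n is at least 2.
    ∃-distinct : ∀ i → ∃[ k ] k ≢ i
    ∃-distinct i with ∃-outside-face (vertices i)
    ... | k , k∉⁅i⁆ = k , λ { ≡.refl → k∉⁅i⁆ (x∈⁅x⁆ i) }

    some-vertex : Fin n
    some-vertex = proj₁ (∃-outside-face ⊥-face)

    -- From a polytope to weights

    module FromPolytope
      (v : Vector (V n) (suc m)) (v∈H₀ : ∀ j → H₀ ℝ (v j)) (full : FullDimensional ℝ v)
      (refines : _Refines_ ℝ (CanonicalFan ℝ K) (NormalFan ℝ (ConvexHull ℝ v))) where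

      -- Refinement puts the cone inside the normal cone of the face on which some `a₀` is maximal.
      -- A point of the list that maximises `a₀` lies in that face, so every functional of the cone
      -- is maximal there too.
      common-maximiser : ∀ {A B} → Face A → AlexanderDual K B → Empty (A ∩ B) →
        ∃[ j ] (∀ {a} → ConeOf ℝ (CanonicalGenerators ℝ A B) a → ∀ i → a · v i ≤ a · v j)
      common-maximiser {A} {B} A∈K B∈K° disjoint
        with refines _ (A , B , A∈K , B∈K° , disjoint , (λ a∈C → a∈C) , (λ a∈C → a∈C))
      ... | D , (a₀ , _ , D⊆N , _) , C⊆D with argmax (λ j → a₀ · v j)
      ... | j , a₀v≤a₀vⱼ = j , λ a∈C i →
        proj₂ (proj₂ (D⊆N (C⊆D a∈C)) (vertex∈hull v j , λ _ → hull-upper a₀ v a₀v≤a₀vⱼ))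
          (v i) (vertex∈hull v i)

      -- `h⁺` and `h⁻` are the values of the support function of the polytope at the δᵢ and at their
      -- negatives; `w` is the width in each coordinate.
      h⁺ h⁻ w : Vector Carrier n
      h⁺ i = v (proj₁ (argmax (λ j → v j i))) i
      h⁻ i = - v (proj₁ (argmax (λ j → - v j i))) i
      w i = h⁺ i + h⁻ i

      q : Carrier
      q = sum h⁻

      v≤h⁺ : ∀ j i → v j i ≤ h⁺ i
      v≤h⁺ j i = proj₂ (argmax (λ j → v j i)) j

      -v≤h⁻ : ∀ j i → - v j i ≤ h⁻ i
      -v≤h⁻ j i = proj₂ (argmax (λ j → - v j i)) j

      -- The coordinates of v j sum to 0, so its heights above the coordinate minima always total
      -- `q`.
      sum[v+h⁻]≈q : ∀ j → sum (λ i → v j i + h⁻ i) ≈ q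
      sum[v+h⁻]≈q j = begin-equality
        sum (λ i → v j i + h⁻ i) ≈⟨ ∑-distrib-+ (v j) h⁻ ⟩
        sum (v j) + q            ≈⟨ +-congʳ (v∈H₀ j) ⟩
        0# + q                   ≈⟨ +-identityˡ q ⟩
        q                        ∎

      -- At a maximiser for the cone (X, ∅) the height above the minimum reaches `w i` on X and is
      -- nonnegative elsewhere, while all heights total `q`.
      face-weight≤q : ∀ X → Face X → weight ℝ w X ≤ q
      face-weight≤q X X∈K
        with common-maximiser {B = ⊥} X∈K ⊥∈K° (λ (_ , i∈X∩⊥) → ∉⊥ (proj₂ (x∈p∩q⁻ X ⊥ i∈X∩⊥)))
      ... | j , max = begin
        weight ℝ w X             ≤⟨ sum-mono-≤ pointwise ⟩
        sum (λ i → v j i + h⁻ i) ≈⟨ sum[v+h⁻]≈q j ⟩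
        q                        ∎
        where
        h⁺≤vⱼ : ∀ i → i ∈ X → h⁺ i ≤ v j i
        h⁺≤vⱼ i i∈X = begin
          v k i       ≈⟨ δ-· i (v∈H₀ k) ⟨
          δ ℝ i · v k ≤⟨ max (δ∈cone i∈X) k ⟩
          δ ℝ i · v j ≈⟨ δ-· i (v∈H₀ j) ⟩
          v j i       ∎
          where k = proj₁ (argmax (λ j → v j i))

        pointwise : ∀ i → (if lookup X i then w i else 0#) ≤ v j i + h⁻ i
        pointwise i with lookup X i in eq
        ... | true  = +-monoˡ-≤ (h⁻ i) (h⁺≤vⱼ i (lookup⇒[]= i X eq))
        ... | false = -x≤y⇒0≤x+y (-v≤h⁻ j i)

      -- Dually, at a maximiser for the cone (∅, ∁ X) the heights vanish off X and are at most `w i`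
      -- on X.
      q≤nonface-weight : ∀ X → ¬ Face X → q ≤ weight ℝ w X
      q≤nonface-weight X X∉K
        with common-maximiser {A = ⊥} ⊥-face (∁-nonface X∉K) (λ (_ , i∈⊥∩∁X) → ∉⊥ (proj₁ (x∈p∩q⁻ ⊥ (∁ X) i∈⊥∩∁X)))
      ... | j , max = begin
        q                        ≈⟨ sum[v+h⁻]≈q j ⟨
        sum (λ i → v j i + h⁻ i) ≤⟨ sum-mono-≤ pointwise ⟩
        weight ℝ w X             ∎
        where
        h⁻≤-vⱼ : ∀ i → i ∉ X → h⁻ i ≤ - v j i
        h⁻≤-vⱼ i i∉X = begin
          - v k i     ≈⟨ δ̄-· i (v∈H₀ k) ⟨
          δ̄ ℝ i · v k ≤⟨ max (δ̄∈cone (x∉p⇒x∈∁p i∉X)) k ⟩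
          δ̄ ℝ i · v j ≈⟨ δ̄-· i (v∈H₀ j) ⟩
          - v j i     ∎
          where k = proj₁ (argmax (λ j → - v j i))

        pointwise : ∀ i → v j i + h⁻ i ≤ (if lookup X i then w i else 0#)
        pointwise i with lookup X i in eq
        ... | true  = +-monoˡ-≤ (h⁻ i) (v≤h⁺ j i)
        ... | false = y≤-x⇒x+y≤0 (h⁻≤-vⱼ i (lookup≡false⇒∉ X i eq))

      -- A nonpositive width makes coordinate i constant on the list, hence by full dimension on
      -- `H₀`; but the points 0 and eᵢ - eₖ of `H₀` differ in it.
      0<w : ∀ i → 0# < w i
      0<w i with ∃-distinct i
      ... | k , k≢i = ≰⇒> λ wᵢ≤0 →
        let h⁺≤v : ∀ j → h⁺ i ≤ v j i
            h⁺≤v j = +-cancelˡ-≤ (- v j i) (begin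
              - v j i + h⁺ i ≈⟨ +-comm _ _ ⟩
              h⁺ i - v j i   ≤⟨ +-monoʳ-≤ (h⁺ i) (-v≤h⁻ j i) ⟩
              w i            ≤⟨ wᵢ≤0 ⟩
              0#             ≈⟨ -‿inverseˡ (v j i) ⟨
              - v j i + v j i ∎)
            const : ∀ {b} → H₀ ℝ b → b i ≈ h⁺ i
            const {b} Σb≈0 = affineHull-const v i (λ j → antisym (v≤h⁺ j i) (h⁺≤v j)) (full b Σb≈0)
        in 0≉1 (begin-equality
          0#                  ≈⟨ const (sum-replicate-zero n) ⟩
          h⁺ i                ≈⟨ const eᵢ-eₖ∈H₀ ⟨
          e ℝ i i - e ℝ k i   ≡⟨ ≡.cong₂ _-_ (e-diagonal i) (e-off-diagonal k≢i) ⟩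
          1# - 0#             ≈⟨ +-congˡ -0#≈0# ⟩
          1# + 0#             ≈⟨ +-identityʳ 1# ⟩
          1#                  ∎)
        where
        eᵢ-eₖ∈H₀ : H₀ ℝ (λ j → e ℝ i j - e ℝ k j)
        eᵢ-eₖ∈H₀ = e-e∈H₀ i k

      roughlyWeighted : RoughlyWeighted ℝ (complementGame K proper)
      roughlyWeighted = w , q , 0<w , 0<q ,
        (λ X q<wX X∈K → <⇒≱ q<wX (face-weight≤q X X∈K)) ,
        (λ X wX<q X∉K → <⇒≱ wX<q (q≤nonface-weight X X∉K))
        where
        0<q : 0# < q
        0<q = begin-strict
          0#                          <⟨ weight-pos 0<w (x∈⁅x⁆ some-vertex) ⟩
          weight ℝ w ⁅ some-vertex ⁆  ≤⟨ face-weight≤q _ (vertices some-vertex) ⟩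
          q                           ∎

    pseudoPolytopal⇒roughlyWeighted : PseudoPolytopal ℝ (CanonicalFan ℝ K) →
                                      RoughlyWeighted ℝ (complementGame K proper)
    -- The affine hull of no points is empty: the empty sum of coefficients would have to be 1.
    pseudoPolytopal⇒roughlyWeighted (zero , _ , _ , full , _) =
      contradiction (proj₁ (proj₂ (full (λ _ → 0#) (sum-replicate-zero n)))) 0≉1
    pseudoPolytopal⇒roughlyWeighted (suc _ , v , v∈H₀ , full , refines) =
      FromPolytope.roughlyWeighted v v∈H₀ full refines

    -- From weights to a polytope

    -- Abstracts the box from its origin, so that the same argument covers the box built from the
    -- weights and the one for the boundary of the simplex.
    module FromBox
      (l r : V n) (l<0 : ∀ i → l i < 0#) (0<r : ∀ i → 0# < r i)
      (face-sum≤0 : ∀ X → Face X → sum (mix l r X) ≤ 0#)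
      (0≤nonface-sum : ∀ X → ¬ Face X → 0# ≤ sum (mix l r X)) where

      l≤r : ∀ i → l i ≤ r i
      l≤r i = ≤-trans (<⇒≤ (l<0 i)) (<⇒≤ (0<r i))

      InBox : V n → Set
      InBox p = ∀ i → l i ≤ p i × p i ≤ r i

      -- Under these equations a point of the section of the box by `H₀` maximises every generator
      -- of the cone (A, B) over that section.
      Supports : Subset n → Subset n → V n → Set
      Supports A B p = (∀ {i} → i ∈ A → p i ≈ r i) × (∀ {i} → i ∈ B → p i ≈ l i)

      Admissible : Subset n → Subset n → Set
      Admissible A B = Face A × AlexanderDual K B × Empty (A ∩ B)

      Vertex : Set
      Vertex = Σ (V n) λ p → H₀ ℝ p × InBox p

      mix-inBox : ∀ X → InBox (mix l r X)
      mix-inBox X i with lookup X i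
      ... | true  = l≤r i , ≤-refl
      ... | false = ≤-refl , l≤r i

      -- Disjointness gives A ⊆ ∁ B, so the corners for A and for ∁ B agree on A, where both are
      -- upper, and on B, where both are lower. Their coordinate sums are ≤ 0 and ≥ 0, so the
      -- segment between them meets `H₀`.
      admissible-vertex : ∀ {A B} → Admissible A B → Σ Vertex (Supports A B ∘ proj₁)
      admissible-vertex {A} {B} (A∈K , B∈K° , disjoint)
        with convex-zero (face-sum≤0 A A∈K) (0≤nonface-sum (∁ B) B∈K°)
      ... | s , t , 0≤s , 0≤t , s+t≈1 , Σ≈0 =
        (p , trans (sum-affine s t (mix l r A) (mix l r (∁ B))) Σ≈0 ,
          λ i → convex-interval 0≤s 0≤t s+t≈1 (mix-inBox A i) (mix-inBox (∁ B) i)) ,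
        (λ {i} i∈A → p≈ i (r i) (mix-∈ {l = l} {r} i∈A) (mix-∈ {l = l} {r} (x∉p⇒x∈∁p λ i∈B → disjoint (i , x∈p∩q⁺ (i∈A , i∈B))))) ,
        (λ {i} i∈B → p≈ i (l i) (mix-∉ {l = l} {r} (λ i∈A → disjoint (i , x∈p∩q⁺ (i∈A , i∈B)))) (mix-∉ {l = l} {r} (x∈p⇒x∉∁p i∈B)))
        where
        p : V n
        p i = s * mix l r A i + t * mix l r (∁ B) i

        p≈ : ∀ i x → mix l r A i ≡ x → mix l r (∁ B) i ≡ x → p i ≈ x
        p≈ i x eqA eqB = trans (+-cong (*-congˡ (reflexive eqA)) (*-congˡ (reflexive eqB))) (convex-const s+t≈1 x)

      -- The origin fills in for pairs that are not admissible, so that one point per pair of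
      -- subsets can be listed.
      extreme-vertex : ∀ A B → Σ Vertex λ p → Admissible A B → Supports A B (proj₁ p)
      extreme-vertex A B with face? A ×-dec ¬? (face? (∁ B)) ×-dec ¬? (nonempty? (A ∩ B))
      ... | yes adm = proj₁ (admissible-vertex adm) , λ _ → proj₂ (admissible-vertex adm)
      ... | no ¬adm = ((λ _ → 0#) , sum-replicate-zero n , λ i → <⇒≤ (l<0 i) , <⇒≤ (0<r i)) ,
                      λ adm → contradiction adm ¬adm

      -- The cube [-ε , ε]ⁿ fits inside the box and leaves room for a small simplex.
      ε-bound : ∃[ ε ] 0# < ε × (∀ i → ε ≤ r i) × (∀ i → ε ≤ - l i)
      ε-bound with positive-lower-bound r 0<r | positive-lower-bound (λ i → - l i) (0<-x ∘ l<0)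
      ... | ε₁ , 0<ε₁ , ε₁≤r | ε₂ , 0<ε₂ , ε₂≤-l with common-lower-bound 0<ε₁ 0<ε₂
      ...   | ε , 0<ε , ε≤ε₁ , ε≤ε₂ = ε , 0<ε , (λ i → ≤-trans ε≤ε₁ (ε₁≤r i)) , (λ i → ≤-trans ε≤ε₂ (ε₂≤-l i))

      ε : Carrier
      ε = proj₁ ε-bound

      0<ε : 0# < ε
      0<ε = proj₁ (proj₂ ε-bound)

      -- A base index: `edge o` vanishes, so the spanning simplex has a vertex at the origin.
      o : Fin n
      o = some-vertex

      edge : Fin n → V n
      edge i k = e ℝ i k - e ℝ o k

      edge-bounds : ∀ i k → - 1# ≤ edge i k × edge i k ≤ 1#
      edge-bounds i k with e-bounds i k | e-bounds o k
      ... | 0≤eᵢ , eᵢ≤1 | 0≤eₒ , eₒ≤1 =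
        (begin
          - 1#      ≈⟨ +-identityˡ _ ⟨
          0# - 1#   ≤⟨ +-mono-≤ 0≤eᵢ (neg-antimono-≤ eₒ≤1) ⟩
          edge i k     ∎) ,
        (begin
          edge i k     ≤⟨ +-mono-≤ eᵢ≤1 (-x≤0 0≤eₒ) ⟩
          1# + 0#   ≈⟨ +-identityʳ 1# ⟩
          1#        ∎)

      spanning-vertex : Fin n → Vertex
      spanning-vertex i = (λ k → ε * edge i k) ,
        trans (sym (*-distribˡ-sum ε (edge i))) (trans (*-congˡ (e-e∈H₀ i o)) (zeroʳ ε)) ,
        λ k →
          (begin
            l k           ≈⟨ -‿involutive (l k) ⟨
            - - l k       ≤⟨ neg-antimono-≤ (proj₂ (proj₂ (proj₂ ε-bound)) k) ⟩
            - ε           ≈⟨ -‿cong (*-identityʳ ε) ⟨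
            - (ε * 1#)    ≈⟨ -‿distribʳ-* ε 1# ⟩
            ε * - 1#      ≤⟨ *-monoˡ-≤-nonneg (<⇒≤ 0<ε) (proj₁ (edge-bounds i k)) ⟩
            ε * edge i k     ∎) ,
          (begin
            ε * edge i k     ≤⟨ *-monoˡ-≤-nonneg (<⇒≤ 0<ε) (proj₂ (edge-bounds i k)) ⟩
            ε * 1#        ≈⟨ *-identityʳ ε ⟩
            ε             ≤⟨ proj₁ (proj₂ (proj₂ ε-bound)) k ⟩
            r k           ∎)

      spanning-affine : FullDimensional ℝ (proj₁ ∘ spanning-vertex)
      spanning-affine b Σb≈0 = c , Σc≈1 , b≋
        where
        -- Since b has coordinate sum 0, it equals Σᵢ bᵢ (eᵢ - eₒ). Dividing by ε gives coefficients
        -- of sum 0; the missing 1 goes to the vertex of index `o`, the origin.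
        c : Vector Carrier n
        c i = ε ⁻¹ * b i + e ℝ o i

        Σc≈1 : sum c ≈ 1#
        Σc≈1 = begin-equality
          sum c                                    ≈⟨ ∑-distrib-+ (λ i → ε ⁻¹ * b i) (e ℝ o) ⟩
          sum (λ i → ε ⁻¹ * b i) + sum (e ℝ o)     ≈⟨ +-cong (sym (*-distribˡ-sum (ε ⁻¹) b)) (sum-e o) ⟩
          ε ⁻¹ * sum b + 1#                        ≈⟨ +-congʳ (trans (*-congˡ Σb≈0) (zeroʳ _)) ⟩
          0# + 1#                                  ≈⟨ +-identityˡ 1# ⟩
          1#                                       ∎

        term : ∀ i k → c i * (ε * edge i k) ≈ b i * edge i k + e ℝ o i * (ε * edge i k)
        term i k = begin-equality
          (ε ⁻¹ * b i + e ℝ o i) * (ε * edge i k)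
            ≈⟨ solve 5 (λ d b o ε f → (d :* b :+ o) :* (ε :* f) := (d :* ε) :* (b :* f) :+ o :* (ε :* f))
                 refl (ε ⁻¹) (b i) (e ℝ o i) ε (edge i k) ⟩
          (ε ⁻¹ * ε) * (b i * edge i k) + e ℝ o i * (ε * edge i k)
            ≈⟨ +-congʳ (trans (*-congʳ (*-inverseˡ (0<⇒≉0 0<ε))) (*-identityˡ _)) ⟩
          b i * edge i k + e ℝ o i * (ε * edge i k) ∎

        Σb·edge : ∀ k → sum (λ i → b i * edge i k) ≈ b k
        Σb·edge k = begin-equality
          sum (λ i → b i * edge i k)
            ≈⟨ sum-cong-≋ (λ i → trans (distribˡ (b i) (e ℝ i k) (- e ℝ o k)) (+-cong (b*e i) (*-comm (b i) _))) ⟩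
          sum (λ i → e ℝ k i * b i + - e ℝ o k * b i)
            ≈⟨ ∑-distrib-+ (λ i → e ℝ k i * b i) (λ i → - e ℝ o k * b i) ⟩
          sum (λ i → e ℝ k i * b i) + sum (λ i → - e ℝ o k * b i)
            ≈⟨ +-cong (sum-e* k b) (sym (*-distribˡ-sum (- e ℝ o k) b)) ⟩
          b k + - e ℝ o k * sum b
            ≈⟨ +-congˡ (trans (*-congˡ Σb≈0) (zeroʳ _)) ⟩
          b k + 0#
            ≈⟨ +-identityʳ _ ⟩
          b k ∎
          where
          b*e : ∀ i → b i * e ℝ i k ≈ e ℝ k i * b i
          b*e i = trans (*-comm _ _) (*-congʳ (reflexive (e-sym i k)))

        b≋ : _≋_ ℝ b (combination ℝ c (proj₁ ∘ spanning-vertex))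
        -- The added term ε * `edge o k` is zero and accounts for the extra coefficient at `o`.
        b≋ k = begin-equality
          b k                                                     ≈⟨ +-identityʳ (b k) ⟨
          b k + 0#                                                ≈⟨ +-congˡ (zeroʳ ε) ⟨
          b k + ε * 0#                                            ≈⟨ +-congˡ (*-congˡ (x-x≈0 {e ℝ o k})) ⟨
          b k + ε * edge o k                                         ≈⟨ +-cong (Σb·edge k) (sum-e* o (λ i → ε * edge i k)) ⟨
          sum (λ i → b i * edge i k) + sum (λ i → e ℝ o i * (ε * edge i k))
            ≈⟨ ∑-distrib-+ (λ i → b i * edge i k) (λ i → e ℝ o i * (ε * edge i k)) ⟨
          sum (λ i → b i * edge i k + e ℝ o i * (ε * edge i k))         ≈⟨ sum-cong-≋ (λ i → term i k) ⟨
          sum (λ i → c i * (ε * edge i k))                           ∎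

      -- Instead of all vertices of the section of the box by H₀, the polytope is
      -- spanned by one supporting point per cone and by a small simplex that
      -- makes it full-dimensional.
      vertices-listable : Σ (List Vertex) λ L →
        (∀ i → spanning-vertex i ∈ₗ L) × (∀ A B → proj₁ (extreme-vertex A B) ∈ₗ L)
      vertices-listable = spanning List.++ extreme ,
        (λ i → ∈-++⁺ˡ (∈-map⁺ spanning-vertex (∈-allFin i))) ,
        (λ A B → ∈-++⁺ʳ spanning (∈-cartesianProductWith⁺ extreme-vertex′ (∈-subsets A) (∈-subsets B)))
        where
        extreme-vertex′ : Subset n → Subset n → Vertex
        extreme-vertex′ A B = proj₁ (extreme-vertex A B)

        spanning extreme : List Vertex
        spanning = List.map spanning-vertex (allFin n)
        extreme = cartesianProductWith extreme-vertex′ (subsets n) (subsets n)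

      module FromVertexList
        (L : List Vertex) (spanning∈ : ∀ i → spanning-vertex i ∈ₗ L)
        (extreme∈ : ∀ A B → proj₁ (extreme-vertex A B) ∈ₗ L) where

        vs : Vector (V n) (List.length L)
        vs j = proj₁ (List.lookup L j)

        vs∈H₀ : ∀ j → H₀ ℝ (vs j)
        vs∈H₀ j = proj₁ (proj₂ (List.lookup L j))

        hull-inBox : ∀ {b} → ConvexHull ℝ vs b → InBox b
        hull-inBox b∈Q i = hull-interval vs i (λ j → proj₂ (proj₂ (List.lookup L j)) i) b∈Q

        full-dimensional : FullDimensional ℝ vs
        full-dimensional b Σb≈0 = affineHull-reindex vs (λ i → Any.index (spanning∈ i)) (b∈ (spanning-affine b Σb≈0))
          where
          b∈ : AffineHull ℝ (λ i → proj₁ (spanning-vertex i)) b →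
               AffineHull ℝ (λ i → vs (Any.index (spanning∈ i))) b
          b∈ (c , Σc≈1 , b≋) = c , Σc≈1 , λ k → trans (b≋ k)
            (sum-cong-≋ (λ i → *-congˡ (reflexive (≡.cong (λ p → proj₁ p k) (lookup-index (spanning∈ i))))))

        supporting-point : ∀ {A B} → Admissible A B → ∃[ p ] ConvexHull ℝ vs p × Supports A B p
        supporting-point {A} {B} adm = vs j , vertex∈hull vs j ,
          ≡.subst (Supports A B ∘ proj₁) (lookup-index (extreme∈ A B)) (proj₂ (extreme-vertex A B) adm)
          where j = Any.index (extreme∈ A B)

        module _ {A B : Subset n} (adm : Admissible A B) where

          σ : V n
          σ i = sign (lookup A i) (lookup B i)

          -- A point in the relative interior of the cone (A , B).
          a₀ : V n
          a₀ = combination ℝ σ (δ ℝ)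

          a₀∈H₀ : H₀ ℝ a₀
          a₀∈H₀ = H₀-combination σ (δ ℝ) δ∈H₀

          a₀-· : ∀ {b} → H₀ ℝ b → a₀ · b ≈ σ · b
          a₀-· {b} Σb≈0 = trans (combination-· σ (δ ℝ) b) (sum-cong-≋ (λ i → *-congˡ {σ i} (δ-· i {b} Σb≈0)))

          -- Maximising `σ` over the box separates into coordinates: the upper end is best on A, the
          -- lower end on B, and all other terms are zero.
          σ-max : ∀ {p b} → Supports A B p → InBox b → ∀ i → σ i * b i ≤ σ i * p i
          σ-max {p} {b} (p≈r , p≈l) b∈box i with lookup A i in eqA | lookup B i in eqB
          ... | true  | _     = *-monoˡ-≤-nonneg (<⇒≤ 0<1)
            (≤-trans (proj₂ (b∈box i)) (≤-reflexive (sym (p≈r (lookup⇒[]= i A eqA)))))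
          ... | false | true  = begin
            - 1# * b i ≈⟨ -1*x≈-x (b i) ⟩
            - b i      ≤⟨ neg-antimono-≤ (≤-trans (≤-reflexive (p≈l (lookup⇒[]= i B eqB))) (proj₁ (b∈box i))) ⟩
            - p i      ≈⟨ -1*x≈-x (p i) ⟨
            - 1# * p i ∎
          ... | false | false = ≤-reflexive (trans (zeroˡ _) (sym (zeroˡ _)))

          σ-∈A : ∀ {i} → i ∈ A → σ i ≡ 1#
          σ-∈A {i} i∈A = ≡.cong (λ a → sign a (lookup B i)) ([]=⇒lookup i∈A)

          σ-∈B : ∀ {i} → i ∈ B → σ i ≡ - 1#
          σ-∈B {i} i∈B = ≡.cong₂ sign (∉⇒lookup≡false A i i∉A) ([]=⇒lookup i∈B)
            where
            i∉A : i ∉ A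
            i∉A i∈A = proj₂ (proj₂ adm) (i , x∈p∩q⁺ (i∈A , i∈B))

          -- On A and B the factor is 1 or -1 and cancels.
          supports-from-σ : ∀ {p b} → Supports A B p → (∀ i → σ i * b i ≈ σ i * p i) → Supports A B b
          supports-from-σ {p} {b} (p≈r , p≈l) σb≈σp = b≈r , b≈l
            where
            b≈r : ∀ {i} → i ∈ A → b i ≈ r i
            b≈r {i} i∈A = begin-equality
              b i        ≈⟨ *-identityˡ _ ⟨
              1# * b i   ≡⟨ ≡.cong (_* b i) (σ-∈A i∈A) ⟨
              σ i * b i  ≈⟨ σb≈σp i ⟩
              σ i * p i  ≡⟨ ≡.cong (_* p i) (σ-∈A i∈A) ⟩
              1# * p i   ≈⟨ *-identityˡ _ ⟩
              p i        ≈⟨ p≈r i∈A ⟩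
              r i        ∎

            b≈l : ∀ {i} → i ∈ B → b i ≈ l i
            b≈l {i} i∈B = trans (-‿injective (begin-equality
              - b i      ≈⟨ -1*x≈-x _ ⟨
              - 1# * b i ≡⟨ ≡.cong (_* b i) (σ-∈B i∈B) ⟨
              σ i * b i  ≈⟨ σb≈σp i ⟩
              σ i * p i  ≡⟨ ≡.cong (_* p i) (σ-∈B i∈B) ⟩
              - 1# * p i ≈⟨ -1*x≈-x _ ⟩
              - p i      ∎)) (p≈l i∈B)

          -- A supporting point p of the hull dominates b term by term in the pairing with `σ`.
          -- Maximality of b gives the reverse inequality between the sums, so all terms agree and b
          -- inherits the equations of p.
          face-supports : ∀ {b} → face ℝ (ConvexHull ℝ vs) a₀ b → Supports A B b
          face-supports {b} (b∈Q , b-max) with supporting-point adm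
          ... | p , p∈Q , sup = supports-from-σ sup (sum-tight (σ-max sup (hull-inBox b∈Q)) (begin
            σ · p  ≈⟨ a₀-· (H₀-hull vs vs∈H₀ p∈Q) ⟨
            a₀ · p ≤⟨ b-max p p∈Q ⟩
            a₀ · b ≈⟨ a₀-· (H₀-hull vs vs∈H₀ b∈Q) ⟩
            σ · b  ∎))

          generator-max : ∀ {b y g} → H₀ ℝ b → H₀ ℝ y → Supports A B b → InBox y →
                          CanonicalGenerators ℝ A B g → g · y ≤ g · b
          generator-max {b} {y} {g} Σb≈0 Σy≈0 (b≈r , _) y∈box (inj₁ (i , i∈A , g≋δ)) = begin
            g · y     ≈⟨ ·-congʳ {b = y} g≋δ ⟩
            δ ℝ i · y ≈⟨ δ-· i Σy≈0 ⟩
            y i       ≤⟨ proj₂ (y∈box i) ⟩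
            r i       ≈⟨ b≈r i∈A ⟨
            b i       ≈⟨ δ-· i Σb≈0 ⟨
            δ ℝ i · b ≈⟨ ·-congʳ {b = b} g≋δ ⟨
            g · b     ∎
          generator-max {b} {y} {g} Σb≈0 Σy≈0 (_ , b≈l) y∈box (inj₂ (i , i∈B , g≋δ̄)) = begin
            g · y     ≈⟨ ·-congʳ {b = y} g≋δ̄ ⟩
            δ̄ ℝ i · y ≈⟨ δ̄-· i Σy≈0 ⟩
            - y i     ≤⟨ neg-antimono-≤ (proj₁ (y∈box i)) ⟩
            - l i     ≈⟨ -‿cong (b≈l i∈B) ⟨
            - b i     ≈⟨ δ̄-· i Σb≈0 ⟨
            δ̄ ℝ i · b ≈⟨ ·-congʳ {b = b} g≋δ̄ ⟨
            g · b     ∎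

          -- Every point of the face satisfies the support equations, hence maximises each
          -- generator, and nonnegative coefficients preserve this.
          cone⊆normalCone : ∀ {a} → ConeOf ℝ (CanonicalGenerators ℝ A B) a →
            NormalCone ℝ (ConvexHull ℝ vs) (face ℝ (ConvexHull ℝ vs) a₀) a
          cone⊆normalCone {a} a∈C@(_ , c , g , 0≤c , g∈G , a≋cg) = cone⊆H₀ A B a∈C ,
            λ {b} b∈F → proj₁ b∈F , λ y y∈Q → begin
              a · y                       ≈⟨ ·-congʳ {b = y} a≋cg ⟩
              combination ℝ c g · y       ≈⟨ combination-· c g y ⟩
              sum (λ j → c j * (g j · y)) ≤⟨ weighted-mono 0≤c (λ j → generator-max
                                               (H₀-hull vs vs∈H₀ (proj₁ b∈F)) (H₀-hull vs vs∈H₀ y∈Q)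
                                               (face-supports b∈F) (hull-inBox y∈Q) (g∈G j)) ⟩
              sum (λ j → c j * (g j · b)) ≈⟨ combination-· c g b ⟨
              combination ℝ c g · b       ≈⟨ ·-congʳ {b = b} a≋cg ⟨
              a · b                       ∎

        pseudoPolytopal : PseudoPolytopal ℝ (CanonicalFan ℝ K)
        pseudoPolytopal = _ , vs , vs∈H₀ , full-dimensional ,
          λ C (A , B , A∈K , B∈K° , disjoint , C⊆ , _) → let adm = A∈K , B∈K° , disjoint in
            _ , (a₀ adm , a₀∈H₀ adm , (λ a∈N → a∈N) , (λ a∈N → a∈N)) , λ a∈C → cone⊆normalCone adm (C⊆ a∈C)

      pseudoPolytopal : PseudoPolytopal ℝ (CanonicalFan ℝ K)
      pseudoPolytopal = let L , spanning∈ , extreme∈ = vertices-listable in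
        FromVertexList.pseudoPolytopal L spanning∈ extreme∈

    -- The corner for X of the box with sides [- q wᵢ , (W - q) wᵢ] has coordinate sum W (w(X) - q),
    -- which has the sign of w(X) - q. The bound `q < sum w` makes the upper ends positive.
    weights⇒pseudoPolytopal : {w : V n} {q : Carrier} → (∀ i → 0# < w i) → 0# < q →
      (∀ X → Face X → weight ℝ w X ≤ q) → (∀ X → ¬ Face X → q ≤ weight ℝ w X) →
      q < sum w → PseudoPolytopal ℝ (CanonicalFan ℝ K)
    weights⇒pseudoPolytopal {w} {q} 0<w 0<q face≤q q≤nonface q<W =
      FromBox.pseudoPolytopal (λ i → - q * w i) (λ i → (W - q) * w i)
        (λ i → begin-strict
          - q * w i   ≈⟨ -‿distribˡ-* q (w i) ⟨
          - (q * w i) <⟨ -x<0 (*-pos 0<q (0<w i)) ⟩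
          0#          ∎)
        (λ i → *-pos (x<y⇒0<y-x q<W) (0<w i))
        (λ X X∈K → begin
          _                          ≈⟨ sum-mix X ⟩
          W * weight ℝ w X + - q * W ≤⟨ +-monoˡ-≤ _ (*-monoˡ-≤-nonneg 0≤W (face≤q X X∈K)) ⟩
          W * q + - q * W            ≈⟨ Wq-qW≈0 ⟩
          0#                         ∎)
        (λ X X∉K → begin
          0#                         ≈⟨ Wq-qW≈0 ⟨
          W * q + - q * W            ≤⟨ +-monoˡ-≤ _ (*-monoˡ-≤-nonneg 0≤W (q≤nonface X X∉K)) ⟩
          W * weight ℝ w X + - q * W ≈⟨ sum-mix X ⟨
          _                          ∎)
      where
      W : Carrier
      W = sum w

      0≤W : 0# ≤ W
      0≤W = sum-nonneg (<⇒≤ ∘ 0<w)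

      Wq-qW≈0 : W * q + - q * W ≈ 0#
      Wq-qW≈0 = begin-equality
        W * q + - q * W ≈⟨ +-cong (*-comm W q) (sym (-‿distribˡ-* q W)) ⟩
        q * W - q * W   ≈⟨ x-x≈0 ⟩
        0#              ∎

      sum-mix : ∀ X → sum (mix (λ i → - q * w i) (λ i → (W - q) * w i) X) ≈ W * weight ℝ w X + - q * W
      sum-mix X = trans (sum-cong-≋ term) (sum-affine W (- q) (λ i → if lookup X i then w i else 0#) w)
        where
        term : ∀ i → mix (λ i → - q * w i) (λ i → (W - q) * w i) X i ≈
                     W * (if lookup X i then w i else 0#) + - q * w i
        term i with lookup X i
        ... | true  = distribʳ (w i) W (- q)
        ... | false = sym (trans (+-congʳ (zeroʳ W)) (+-identityˡ _))

    -- The only nonface is now `⊤`. In the box with sides [-n , 1] the corner for `⊤` has a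
    -- nonnegative sum, while a single lower coordinate outweighs all the upper ones.
    boundary⇒pseudoPolytopal : (∀ i → Face (∁ ⁅ i ⁆)) → PseudoPolytopal ℝ (CanonicalFan ℝ K)
    boundary⇒pseudoPolytopal facets =
      FromBox.pseudoPolytopal (λ _ → - fromℕ n) (λ _ → 1#)
        (λ i → -x<0 (≤∧≉⇒< (fromℕ-nonneg n) (fromℕ≉0 i ∘ sym)))
        (λ _ → 0<1)
        face-sum≤0 0≤nonface-sum
      where
      face-sum≤0 : ∀ X → Face X → sum (mix (λ _ → - fromℕ n) (λ _ → 1#) X) ≤ 0#
      face-sum≤0 X X∈K with ∃-outside-face X∈K
      ... | i , i∉X = begin
        sum (mix (λ _ → - fromℕ n) (λ _ → 1#) X)           ≤⟨ sum-mono-≤ bound ⟩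
        sum (λ k → 1# * 1# + - fromℕ n * e ℝ i k)          ≈⟨ sum-affine 1# (- fromℕ n) (λ _ → 1#) (e ℝ i) ⟩
        1# * sum {n} (λ _ → 1#) + - fromℕ n * sum (e ℝ i)  ≈⟨ +-cong (trans (*-identityˡ _) (sum-ones n)) (trans (*-congˡ (sum-e i)) (*-identityʳ _)) ⟩
        fromℕ n - fromℕ n                                  ≈⟨ x-x≈0 ⟩
        0#                                                 ∎
        where
        -- The bounding vector is 1 - n at the missing index i and 1 elsewhere, so its sum is 0.
        bound : ∀ k → mix (λ _ → - fromℕ n) (λ _ → 1#) X k ≤ 1# * 1# + - fromℕ n * e ℝ i k
        bound k with lookup X k in eq
        ... | true  = ≤-reflexive (begin-equality
          1#                                   ≈⟨ *-identityˡ 1# ⟨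
          1# * 1#                              ≈⟨ +-identityʳ _ ⟨
          1# * 1# + 0#                         ≈⟨ +-congˡ (zeroʳ _) ⟨
          1# * 1# + - fromℕ n * 0#             ≡⟨ ≡.cong (λ z → 1# * 1# + - fromℕ n * z) (e-off-diagonal i≢k) ⟨
          1# * 1# + - fromℕ n * e ℝ i k        ∎)
          where
          i≢k : i ≢ k
          i≢k ≡.refl = i∉X (lookup⇒[]= k X eq)
        ... | false = begin
          - fromℕ n                            ≈⟨ +-identityˡ _ ⟨
          0# - fromℕ n                         ≈⟨ +-congˡ (-‿cong (*-identityʳ _)) ⟨
          0# - fromℕ n * 1#                    ≤⟨ +-mono-≤ (*-nonneg (<⇒≤ 0<1) (<⇒≤ 0<1))
                                                    (neg-antimono-≤ (*-monoˡ-≤-nonneg (fromℕ-nonneg n) (proj₂ (e-bounds i k)))) ⟩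
          1# * 1# - fromℕ n * e ℝ i k          ≈⟨ +-congˡ (-‿distribˡ-* _ _) ⟩
          1# * 1# + - fromℕ n * e ℝ i k        ∎

      0≤nonface-sum : ∀ X → ¬ Face X → 0# ≤ sum (mix (λ _ → - fromℕ n) (λ _ → 1#) X)
      -- An index missing from X would put X inside the face `∁ ⁅ i ⁆`; hence every coordinate of
      -- the corner is 1.
      0≤nonface-sum X X∉K = sum-nonneg λ i → begin
        0#                                     ≤⟨ <⇒≤ 0<1 ⟩
        1#                                     ≡⟨ mix-∈ (decidable-stable (i ∈? X) (λ i∉X → X∉K (down-closed (X⊆∁⁅i⁆ i∉X) (facets i)))) ⟨
        mix (λ _ → - fromℕ n) (λ _ → 1#) X i   ∎
        where
        X⊆∁⁅i⁆ : ∀ {i} → i ∉ X → X ⊆ ∁ ⁅ i ⁆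
        X⊆∁⁅i⁆ {i} i∉X k∈X = x∉p⇒x∈∁p (λ k∈⁅i⁆ → i∉X (≡.subst (_∈ X) (x∈⁅y⁆⇒x≡y i k∈⁅i⁆) k∈X))

    roughlyWeighted⇒pseudoPolytopal : RoughlyWeighted ℝ (complementGame K proper) →
                                      PseudoPolytopal ℝ (CanonicalFan ℝ K)
    roughlyWeighted⇒pseudoPolytopal (w , q , 0<w , 0<q , wins , loses)
      -- A nonface `∁ ⁅ i ⁆` has weight at least `q` and, as wᵢ is positive, less than W, so the box
      -- from the weights applies. If there is none, K is the boundary of the simplex.
      with any? (λ i → ¬? (face? (∁ ⁅ i ⁆)))
    ... | no  all-facets =
      boundary⇒pseudoPolytopal λ i → decidable-stable (face? (∁ ⁅ i ⁆)) (λ ∉K → all-facets (i , ∉K))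
    ... | yes (i , ∁⁅i⁆∉K) = weights⇒pseudoPolytopal 0<w 0<q face≤q q≤nonface (begin-strict
        q                     ≤⟨ q≤nonface _ ∁⁅i⁆∉K ⟩
        weight ℝ w (∁ ⁅ i ⁆)  <⟨ sum-mono-< bound i boundᵢ ⟩
        sum w                 ∎)
      where
      face≤q : ∀ X → Face X → weight ℝ w X ≤ q
      face≤q X X∈K = ≮⇒≥ (λ q<wX → wins X q<wX X∈K)

      q≤nonface : ∀ X → ¬ Face X → q ≤ weight ℝ w X
      q≤nonface X X∉K = ≮⇒≥ (λ wX<q → loses X wX<q X∉K)

      bound : ∀ k → (if lookup (∁ ⁅ i ⁆) k then w k else 0#) ≤ w k
      bound k with lookup (∁ ⁅ i ⁆) k
      ... | true  = ≤-refl
      ... | false = <⇒≤ (0<w k)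

      boundᵢ : (if lookup (∁ ⁅ i ⁆) i then w i else 0#) < w i
      boundᵢ rewrite ∉⇒lookup≡false (∁ ⁅ i ⁆) i (x∈p⇒x∉∁p (x∈⁅x⁆ i)) = 0<w i

theorem1p2 : (ℝ : CompleteOrderedField) (n : ℕ) (K : SimplicialComplex n)
    (proper : Proper K) → FullVertexSet K →
    RoughlyWeighted ℝ (complementGame K proper) ⇔ PseudoPolytopal ℝ (CanonicalFan ℝ K)
theorem1p2 ℝ n K proper vertices = mk⇔
  (roughlyWeighted⇒pseudoPolytopal K proper vertices)
  (pseudoPolytopal⇒roughlyWeighted K proper vertices)
  where open OverReals ℝ
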